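{- Let $D=(V,A)$ be a vertebrate directed acyclic graph. Then the acyclic reorientation poset $\mathcal{AR}_D$ is a lattice, where the join (resp. meet) of a set of acyclic reorientations $E_1,\dots,E_k$ of $D$ is the reorientation obtained from $D$ by reversing all arcs of $A$ that belong (resp. do not belong) to the transitive closure of the set of arcs of $D$ that are reversed (resp. not reversed) in at least one of the reorientations $E_1,\dots,E_k$.
   Context: All directed graphs are finite and simple. A reorientation of a directed acyclic graph $D=(V,A)$ is a directed graph with the same underlying undirected graph, encoded by the set of arcs of $D$ that it reverses. $\mathcal{AR}_D$ is the poset of acyclic reorientations of $D$ ordered by inclusion of sets of reversed arcs. The transitive reduction of a directed acyclic graph is obtained by deleting all arcs whose endpoints are connected by a directed path of length at least $2$. A directed graph is a forest if its underlying undirected graph has no cycle. $D$ is vertebrate if the transitive reduction of every induced subgraph of $D$ is a forest. The transitive closure of a set $B\subseteq A$ of arcs of $D$ is the set of pairs $(u,v)$ such that there is a directed path of length at least $1$ from $u$ to $v$ formed by arcs of $B$ (arcs taken with their orientation in $D$). -}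

module Defs where

open import Data.Fin.Base using (Fin)
open import Data.Fin.Subset using (Subset; _∈_)
open import Data.List.Base using (List; _∷_; _∷ʳ_; length)
open import Data.List.Relation.Unary.Linked using (Linked)
open import Data.List.Relation.Unary.Unique.Propositional using (Unique)
open import Data.Nat.Base using (ℕ; _≤_)
open import Data.Product.Base using (∃; ∃-syntax; ∃₂; _×_; _,_; proj₁; swap)
open import Function.Base using (_∘_; _on_; flip; id)
open import Level using (0ℓ; suc; _⊔_)
open import Relation.Binary.Bundles using (Poset)
open import Relation.Binary.Construct.Closure.Symmetric using (SymClosure)
open import Relation.Binary.Construct.Closure.Transitive using (TransClosure)
open import Relation.Binary.Construct.Union using (_∪_)
open import Relation.Binary.Core using (Rel; _⇒_; _⇔_)
open import Relation.Binary.Definitions using (Decidable)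
open import Relation.Binary.Lattice.Structures using (IsLattice)
open import Relation.Nullary.Negation.Core using (¬_)

-- Arc sets over a vertex type V are relations on V.

Acyclic : {V : Set} → Rel V 0ℓ → Set
Acyclic A = ∀ v → ¬ TransClosure A v v

-- A first arc u → w followed by a path of length at least 1 from w to v.

LongPath : {V : Set} → Rel V 0ℓ → Rel V 0ℓ
LongPath A u v = ∃[ w ] A u w × TransClosure A w v

TransReduction : {V : Set} → Rel V 0ℓ → Rel V 0ℓ
TransReduction A u v = A u v × ¬ LongPath A u v

-- The cycle through x and then xs, at least three distinct vertices in all,
-- in the undirected graph with adjacency relation G.

IsCycle : {V : Set} → Rel V 0ℓ → V → List V → Set
IsCycle G x xs = 2 ≤ length xs × Unique (x ∷ xs) × Linked G (x ∷ (xs ∷ʳ x))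

Forest : {V : Set} → Rel V 0ℓ → Set
Forest A = ∀ x xs → ¬ IsCycle (SymClosure A) x xs

-- Simplicity needs no separate fields: a relation has no parallel arcs, and
-- acyclicity excludes loops and pairs of opposite arcs.

record DAG : Set₁ where
  field
    size    : ℕ
    Arc     : Rel (Fin size) 0ℓ
    arc?    : Decidable Arc
    acyclic : Acyclic Arc

  Vertex : Set
  Vertex = Fin size

Induced : (D : DAG) (U : Subset (DAG.size D)) → Rel (∃ (_∈ U)) 0ℓ
Induced D U = DAG.Arc D on proj₁

Vertebrate : DAG → Set
Vertebrate D = ∀ U → Forest (TransReduction (Induced D U))

-- Used only with B ⊆ A.

reorient : {V : Set} → Rel V 0ℓ → Rel V 0ℓ → Rel V 0ℓ
reorient A B = (λ u v → A u v × ¬ B u v) ∪ flip B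

record AcyclicReorientation (D : DAG) : Set₁ where
  open DAG D using (Vertex; Arc)
  field
    Reversed     : Rel Vertex 0ℓ
    reversed?    : Decidable Reversed
    reversed⊆arc : Reversed ⇒ Arc
    acyclic      : Acyclic (reorient Arc Reversed)

  Unreversed : Rel Vertex 0ℓ
  Unreversed u v = Arc u v × ¬ Reversed u v

open AcyclicReorientation public using (Reversed; Unreversed)

AR : DAG → Poset (suc 0ℓ) 0ℓ 0ℓ
AR D = record
  { Carrier        = AcyclicReorientation D
  ; _≈_            = λ E F → Reversed E ⇔ Reversed F
  ; _≤_            = λ E F → Reversed E ⇒ Reversed F
  ; isPartialOrder = record
    { isPreorder = record
      { isEquivalence = record
        { refl  = id , id
        ; sym   = swap
        ; trans = λ (f , f⁻) (g , g⁻) → g ∘ f , f⁻ ∘ g⁻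
        }
      ; reflexive = λ (f , _) → f
      ; trans     = λ f g → g ∘ f
      }
    ; antisym = λ f g → f , g
    }
  }

module _ {c ℓ₁ ℓ₂} (P : Poset c ℓ₁ ℓ₂) where
  private module P = Poset P

  HasLattice : Set (c ⊔ ℓ₁ ⊔ ℓ₂)
  HasLattice = ∃₂ λ _∨_ _∧_ → IsLattice P._≈_ P._≤_ _∨_ _∧_

  IsJoin : ∀ {k} → (Fin k → P.Carrier) → P.Carrier → Set (c ⊔ ℓ₂)
  IsJoin E x = (∀ i → E i P.≤ x) × (∀ y → (∀ i → E i P.≤ y) → x P.≤ y)

  IsMeet : ∀ {k} → (Fin k → P.Carrier) → P.Carrier → Set (c ⊔ ℓ₂)
  IsMeet E x = (∀ i → x P.≤ E i) × (∀ y → (∀ i → y P.≤ E i) → y P.≤ x)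

module _ (D : DAG) {k : ℕ} (E : Fin k → AcyclicReorientation D) where
  open DAG D using (Vertex; Arc)

  SomeReversed : Rel Vertex 0ℓ
  SomeReversed u v = ∃[ i ] Reversed (E i) u v

  SomeUnreversed : Rel Vertex 0ℓ
  SomeUnreversed u v = ∃[ i ] Unreversed (E i) u v

  JoinArcs : Rel Vertex 0ℓ
  JoinArcs u v = Arc u v × TransClosure SomeReversed u v

  MeetArcs : Rel Vertex 0ℓ
  MeetArcs u v = Arc u v × ¬ TransClosure SomeUnreversed u v

{-# OPTIONS --safe #-}

-- A set B of arcs of D is the reversed set of an acyclic reorientation as soon as no arc of B
-- is parallel to a path outside B and no arc outside B is parallel to a path in B: a shortest
-- directed cycle of the reorientation is chordless in D, so, D being vertebrate, it consists
-- of one arc of D and a path of D parallel to it.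
--
-- For joins, let R be the union of the sets of reversed arcs and N the set of arcs outside the
-- closure of R. An arc of R is never parallel to a path outside R, and likewise for N. Suppose
-- that an R-path and an N-path lead from u to v, with first arcs u → p and u → q, where p and q
-- are chosen as low as possible. In the subgraph of D on the vertices of all such paths, u → p
-- and u → q cannot both survive in the transitive reduction: reduced paths from p and q to v
-- would close a cycle through u. If, say, u → p does not survive, then there is an arc x → p
-- with x on an N-path from u to v. Being parallel to u → p ∈ R, the path from u through x to p
-- meets R, so x → p belongs to R, and x and v are again joined by an R-path and an N-path.
-- Hence R-paths and N-paths are never parallel, which is what acyclicity of the join requires.
-- Meets are obtained from the complementary sets of arcs.

module Submission where

open import Defs
open import Data.Fin.Base using (Fin; zero; suc)
open import Data.Fin.Induction using (spo-wellFounded; spo-noetherian)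
open import Data.Fin.Properties using (any?; _≟_)
open import Data.Fin.Subset using (Subset) renaming (_∈_ to _∈ˢ_)
open import Data.List.Base using ([]; _∷_; _∷ʳ_; _++_; applyUpTo; length; map)
import Data.List.Membership.DecPropositional as DecMembership
open import Data.List.Membership.Propositional using (_∈_)
open import Data.List.Membership.Propositional.Properties using (∈-++⁺ʳ; ∈-applyUpTo⁺; ∈-applyUpTo⁻)
open import Data.List.Properties using (++-assoc; applyUpTo-∷ʳ; length-applyUpTo; length-map; map-++)
open import Data.List.Relation.Unary.All as All using (All; []; _∷_)
import Data.List.Relation.Unary.All.Properties as All
import Data.List.Relation.Unary.AllPairs as AllPairs
open import Data.List.Relation.Unary.Any using (here; there)
open import Data.List.Relation.Unary.Linked as Linked using (Linked; []; [-]; _∷_)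
import Data.List.Relation.Unary.Linked.Properties as Linked
open import Data.List.Relation.Unary.Unique.Propositional using (Unique)
import Data.List.Relation.Unary.Unique.Propositional.Properties as Unique
open import Data.Nat.Base as ℕ using (ℕ; zero; suc; _+_; _∸_; s≤s; z≤n)
open import Data.Nat.DivMod using (_%_; m%n<n; m%n%n≡m%n; [m+n]%n≡m%n; m<n⇒m%n≡m; n%n≡0; %-distribˡ-+)
open import Data.Nat.Induction using (<-rec)
import Data.Nat.Properties as ℕ
open import Data.Product.Base using (∃; ∃-syntax; ∃₂; Σ-syntax; _×_; _,_; proj₁; proj₂)
open import Data.Sum.Base using (_⊎_; inj₁; inj₂; [_,_]′; swap)
open import Data.Vec.Base using (tabulate)
open import Data.Vec.Properties using ([]=⇒lookup; lookup⇒[]=; lookup∘tabulate)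
open import Function.Base using (_∘_; _on_; flip; id)
open import Induction.WellFounded using (WellFounded; Acc; acc)
open import Level using (0ℓ)
open import Relation.Binary.Bundles using (Poset)
open import Relation.Binary.Construct.Closure.ReflexiveTransitive as Star using (Star; ε; _◅_; _◅◅_)
open import Relation.Binary.Construct.Closure.Symmetric as Sym using (SymClosure; fwd; bwd)
open import Relation.Binary.Construct.Closure.Transitive as Plus using (TransClosure; [_]; _∷_)
open import Relation.Binary.Core using (Rel; _⇒_; _⇔_)
open import Relation.Binary.Definitions using (Decidable; tri<; tri≈; tri>)
open import Relation.Binary.PropositionalEquality
  using (_≡_; _≢_; refl; sym; trans; cong; subst; isEquivalence; resp₂; module ≡-Reasoning)
open import Relation.Binary.Structures using (IsStrictPartialOrder)
open import Relation.Nullary.Decidable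
  using (Dec; yes; no; does; map′; _×-dec_; _⊎-dec_; ¬?; dec-true; decidable-stable)
open import Relation.Nullary.Negation using (¬_; contradiction)
open import Relation.Unary using (Pred)
import Relation.Unary as Unary

-- Paths and linked lists

gmap⁺ : ∀ {A B : Set} {R : Rel A 0ℓ} {S : Rel B 0ℓ} (f : A → B) →
        (∀ {x y} → R x y → S (f x) (f y)) →
        ∀ {x y} → TransClosure R x y → TransClosure S (f x) (f y)
gmap⁺ f R⇒S [ r ]   = [ R⇒S r ]
gmap⁺ f R⇒S (r ∷ p) = R⇒S r ∷ gmap⁺ f R⇒S p

map⁺ : ∀ {A : Set} {R S : Rel A 0ℓ} → R ⇒ S → TransClosure R ⇒ TransClosure S
map⁺ = gmap⁺ id

module _ {A : Set} {R : Rel A 0ℓ} where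

  reverse⁺ : TransClosure R ⇒ flip (TransClosure (flip R))
  reverse⁺ [ r ]   = [ r ]
  reverse⁺ (r ∷ p) = reverse⁺ p Plus.∷ʳ r

  infixr 5 _◅⁺_

  _◅⁺_ : ∀ {x y z} → R x y → Star R y z → TransClosure R x z
  r ◅⁺ ε       = [ r ]
  r ◅⁺ (s ◅ p) = r ∷ (s ◅⁺ p)

  ⁺⇒⋆ : TransClosure R ⇒ Star R
  ⁺⇒⋆ [ r ]   = r ◅ ε
  ⁺⇒⋆ (r ∷ p) = r ◅ ⁺⇒⋆ p

  uncons⁺ : ∀ {x z} → TransClosure R x z → ∃[ y ] R x y × Star R y z
  uncons⁺ [ r ]   = _ , r , ε
  uncons⁺ (r ∷ p) = _ , r , ⁺⇒⋆ p

  unsnoc⁺ : ∀ {x z} → TransClosure R x z → ∃[ y ] Star R x y × R y z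
  unsnoc⁺ [ r ]   = _ , ε , r
  unsnoc⁺ (r ∷ p) with y , q , s ← unsnoc⁺ p = y , r ◅ q , s

  concat⁺ : TransClosure (TransClosure R) ⇒ TransClosure R
  concat⁺ [ p ]   = p
  concat⁺ (p ∷ q) = p Plus.++ concat⁺ q

  infixr 5 _⋆++⁺_

  _⋆++⁺_ : ∀ {x y z} → Star R x y → TransClosure R y z → TransClosure R x z
  ε       ⋆++⁺ q = q
  (r ◅ p) ⋆++⁺ q = r ∷ (p ⋆++⁺ q)

  linked-∷ʳ : ∀ xs {x y} → Linked R (xs ∷ʳ x) → R x y → Linked R ((xs ∷ʳ x) ∷ʳ y)
  linked-∷ʳ []           _       r = r ∷ [-]
  linked-∷ʳ (_ ∷ [])     (s ∷ _) r = s ∷ r ∷ [-]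
  linked-∷ʳ (_ ∷ y ∷ xs) (s ∷ l) r = s ∷ linked-∷ʳ (y ∷ xs) l r

  linked-glue : ∀ xs {x ys} → Linked R (xs ∷ʳ x) → Linked R (x ∷ ys) → Linked R (xs ++ x ∷ ys)
  linked-glue []           _       l = l
  linked-glue (_ ∷ [])     (r ∷ _) l = r ∷ l
  linked-glue (_ ∷ y ∷ xs) (r ∷ k) l = r ∷ linked-glue (y ∷ xs) k l

  linked-++⁻ˡ : ∀ xs {ys} → Linked R (xs ++ ys) → Linked R xs
  linked-++⁻ˡ []           _       = []
  linked-++⁻ˡ (_ ∷ [])     _       = [-]
  linked-++⁻ˡ (_ ∷ y ∷ xs) (r ∷ l) = r ∷ linked-++⁻ˡ (y ∷ xs) l

  -- Each entry reaches every later one, so a repeated entry would lie on a directed cycle.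
  linked⇒unique : Acyclic R → ∀ {xs} → Linked R xs → Unique xs
  linked⇒unique acyclic =
    AllPairs.map (λ { p refl → acyclic _ p }) ∘
    Linked.Linked⇒AllPairs (Plus.transitive R) ∘ Linked.map [_]

  -- The last component is kept for `reduced-fork`, where it helps to rule out a cycle of only two
  -- vertices.
  split-at-first : ∀ {P : Pred A 0ℓ} → Unary.Decidable P → ∀ {u a v} →
    R u a → Star R a v → P v →
    ∃₂ λ as x → Linked R (u ∷ (as ∷ʳ x)) × All (¬_ ∘ P) as × P x × a ∈ as ∷ʳ x
  split-at-first P? {a = a} r p v∈P with P? a
  ... | yes a∈P = [] , a , r ∷ [-] , [] , a∈P , here refl
  split-at-first P? r ε       v∈P | no a∉P = contradiction v∈P a∉P
  split-at-first P? r (s ◅ p) v∈P | no a∉P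
    with as , x , l , as∉P , x∈P , _ ← split-at-first P? s p v∈P
    = _ ∷ as , x , r ∷ l , a∉P ∷ as∉P , x∈P , here refl

module _ {A : Set} {R : Rel A 0ℓ} where

  backtrack : ∀ {u a x} → R u a → Star R a x →
    ∃[ rs ] Linked (flip R) (x ∷ (rs ∷ʳ u)) × All (Star R a) rs × a ∈ x ∷ rs
  backtrack r ε = [] , r ∷ [-] , [] , here refl
  backtrack {a = a} {x} r (s ◅ p) with rs , l , reach , _ ← backtrack s p
    = rs ∷ʳ a , linked-∷ʳ (x ∷ rs) l r , All.∷ʳ⁺ (All.map (s ◅_) reach) ε , there (∈-++⁺ʳ rs (here refl))

acyclic-flip : ∀ {A : Set} {R : Rel A 0ℓ} → Acyclic R → Acyclic (flip R)
acyclic-flip acyclic v p = acyclic v (reverse⁺ p)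

longPath-flip : ∀ {V : Set} {R : Rel V 0ℓ} {u v} → LongPath R u v → LongPath (flip R) v u
longPath-flip {R = R} (w , a , p) = go a p
  where
  go : ∀ {u w v} → R u w → TransClosure R w v → LongPath (flip R) v u
  go a [ b ]   = _ , b , [ a ]
  go a (b ∷ p) with z , c , q ← go b p = z , c , q Plus.∷ʳ a

-- Induced subgraphs given by predicates

module OnSubset {V : Set} (A : Rel V 0ℓ) (U : Pred V 0ℓ) where

  -- Membership is part of the arc, so that paths stay on the vertex type `V`; `vertebrate⇒forest`
  -- makes the passage to `Induced`.
  ArcIn : Rel V 0ℓ
  ArcIn u v = U u × U v × A u v

  ArcIn⇒A : ArcIn ⇒ A
  ArcIn⇒A (_ , _ , a) = a

  Reduced : Rel V 0ℓ
  Reduced = TransReduction ArcIn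

  Reduced⇒A : Reduced ⇒ A
  Reduced⇒A ((_ , _ , a) , _) = a

-- For acyclic `R` this omits the start `u`, which the case distinctions treat separately, but
-- allows the end `v`.
Between : ∀ {V : Set} → Rel V 0ℓ → V → V → Pred V 0ℓ
Between R u v x = TransClosure R u x × Star R x v

-- Closed walks and periodic tours

data Walk {V : Set} (T : Rel V 0ℓ) : ℕ → V → V → Set where
  []  : ∀ {a} → Walk T 0 a a
  _∷_ : ∀ {n a b c} → T a b → Walk T n b c → Walk T (suc n) a c

module _ {V : Set} {T : Rel V 0ℓ} where

  -- The length is made explicit, and nonzero, for the induction in `no-closed-walk`.
  ⁺⇒walk : ∀ {a b} → TransClosure T a b → ∃[ n ] Walk T (suc n) a b
  ⁺⇒walk [ t ]   = 0 , t ∷ []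
  ⁺⇒walk (t ∷ p) with n , w ← ⁺⇒walk p = suc n , t ∷ w

  vertexAt : ∀ {n a b} → Walk T n a b → ℕ → V
  vertexAt {a = a} []      _       = a
  vertexAt {a = a} (_ ∷ _) zero    = a
  vertexAt         (_ ∷ w) (suc i) = vertexAt w i

  vertexAt-start : ∀ {n a b} (w : Walk T n a b) → vertexAt w 0 ≡ a
  vertexAt-start []      = refl
  vertexAt-start (_ ∷ _) = refl

  vertexAt-end : ∀ {n a b} (w : Walk T n a b) → vertexAt w n ≡ b
  vertexAt-end []      = refl
  vertexAt-end (_ ∷ w) = vertexAt-end w

  vertexAt-step : ∀ {n a b} (w : Walk T n a b) {i} → i ℕ.< n →
                  T (vertexAt w i) (vertexAt w (suc i))
  vertexAt-step (t ∷ w) {zero}  _         = subst (T _) (sym (vertexAt-start w)) t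
  vertexAt-step (t ∷ w) {suc i} (s≤s i<n) = vertexAt-step w i<n

-- A closed T-walk of m + 1 steps with vertex set U, unrolled to a periodic sequence.
record Tour {V : Set} (T : Rel V 0ℓ) (U : Pred V 0ℓ) (m : ℕ) (f : ℕ → V) : Set where
  field
    step    : ∀ i → T (f i) (f (suc i))
    period  : ∀ i → f (i + suc m) ≡ f i
    visits  : ∀ i → U (f i)
    covered : ∀ {x} → U x → ∃[ i ] i ℕ.≤ m × x ≡ f i

  walk : ∀ i k → Walk T k (f i) (f (k + i))
  walk i zero    = []
  walk i (suc k) = step i ∷ subst (λ j → Walk T k (f (suc i)) (f j)) (ℕ.+-suc k i) (walk (suc i) k)

  walk-to : ∀ {i j} → i ℕ.≤ j → Walk T (j ∸ i) (f i) (f j)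
  walk-to {i} {j} i≤j = subst (λ k → Walk T (j ∸ i) (f i) (f k)) (ℕ.m∸n+n≡m i≤j) (walk i (j ∸ i))

-- Rotation makes every step of a tour the closing step of some tour, so that only closing steps
-- need an argument.
shift-tour : ∀ {V : Set} {T : Rel V 0ℓ} {U m f} → Tour T U m f → Tour T U m (f ∘ suc)
shift-tour {m = m} {f} tour = record
  { step    = step ∘ suc
  ; period  = period ∘ suc
  ; visits  = visits ∘ suc
  ; covered = λ Ux → shift (covered Ux)
  }
  where
  open Tour tour
  shift : ∀ {x} → ∃[ i ] i ℕ.≤ m × x ≡ f i → ∃[ i ] i ℕ.≤ m × x ≡ f (suc i)
  shift (zero  , _   , refl) = m , ℕ.≤-refl , sym (period 0)
  shift (suc i , i<m , refl) = i , ℕ.<⇒≤ i<m , refl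

closed-walk⇒tour : ∀ {V : Set} {T : Rel V 0ℓ} {m a} → Walk T (suc m) a a →
                   ∃[ f ] Tour T (_∈ applyUpTo f (suc m)) m f
closed-walk⇒tour {T = T} {m} {a} w = f , record
  { step    = λ i → step i (ℕ.m≤n⇒m<n∨m≡n (m%n<n i n))
  ; period  = λ i → cong g ([m+n]%n≡m%n i n)
  ; visits  = λ i → subst (_∈ applyUpTo f n) (cong g (m%n%n≡m%n i n)) (∈-applyUpTo⁺ f (m%n<n i n))
  ; covered = λ x∈ → covered (∈-applyUpTo⁻ f x∈)
  }
  where
  n = suc m
  g = vertexAt w
  f = λ i → g (i % n)
  covered : ∀ {x} → ∃[ i ] i ℕ.< n × x ≡ f i → ∃[ i ] i ℕ.≤ m × x ≡ f i
  covered (i , s≤s i≤m , eq) = i , i≤m , eq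
  suc-% : ∀ i → suc i % n ≡ suc (i % n) % n
  suc-% i = begin
    suc i % n                   ≡⟨ %-distribˡ-+ 1 i n ⟩
    (1 % n + i % n) % n         ≡⟨ cong (λ k → (1 % n + k) % n) (m%n%n≡m%n i n) ⟨
    (1 % n + (i % n) % n) % n   ≡⟨ %-distribˡ-+ 1 (i % n) n ⟨
    suc (i % n) % n             ∎
    where open ≡-Reasoning
  step : ∀ i → suc (i % n) ℕ.< n ⊎ suc (i % n) ≡ n → T (f i) (f (suc i))
  step i (inj₁ lt) = subst (λ k → T (f i) (g k)) (sym (trans (suc-% i) (m<n⇒m%n≡m lt)))
                       (vertexAt-step w (m%n<n i n))
  -- The wrap-around: position `n` of the walk is its end, which is also its start.
  step i (inj₂ eq) = subst (T (f i)) back (vertexAt-step w (m%n<n i n))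
    where
    back : g (suc (i % n)) ≡ f (suc i)
    back = trans (cong g eq) (trans (vertexAt-end w) (trans (sym (vertexAt-start w))
             (cong g (sym (trans (suc-% i) (trans (cong (_% n) eq) (n%n≡0 n)))))))

-- Shortest tours are chordless

module _ {V : Set} {T : Rel V 0ℓ} {U : Pred V 0ℓ} {m : ℕ} {f : ℕ → V} (tour : Tour T U m f)
         (shortest : ∀ {l} → l ℕ.< m → ∀ a → ¬ Walk T (suc l) a a) where
  open Tour tour

  -- A repetition would cut off a closed walk of `j ∸ i` steps, hence of at most `m`.
  distinct : ∀ {i j} → i ℕ.< j → j ℕ.< suc m → f i ≢ f j
  distinct {i} {j} i<j (s≤s j≤m) eq =
    shortest l<m (f i) (step i ∷ subst (Walk T _ _) (sym eq) (walk-to i<j))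
    where
    l<m : j ∸ suc i ℕ.< m
    l<m = ℕ.≤-trans (ℕ.∸-monoʳ-< (ℕ.n<1+n i) i<j) (ℕ.≤-trans (ℕ.m∸n≤m j i) j≤m)

  -- The chord would replace at least two steps of the tour; the rest leads from `f j` once around
  -- to `f (i + suc m)`, which is `f i`.
  no-forward-chord : ∀ {i j} → suc i ℕ.< j → j ℕ.≤ m → ¬ T (f i) (f j)
  no-forward-chord {i} {j} i+1<j j≤m t =
    shortest l<m (f i) (t ∷ subst (Walk T _ (f j)) (period i) (walk-to j≤i+n))
    where
    instance _ = ℕ.>-nonZero {m} (ℕ.≤-trans (s≤s z≤n) (ℕ.≤-trans i+1<j j≤m))
    j≤i+n : j ℕ.≤ i + suc m
    j≤i+n = ℕ.≤-trans j≤m (ℕ.≤-trans (ℕ.n≤1+n m) (ℕ.m≤n+m (suc m) i))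
    l<m : i + suc m ∸ j ℕ.< m
    l<m = ℕ.m<n+o⇒m∸n<o (i + suc m) j (subst (ℕ._< j + m) (sym (ℕ.+-suc i m)) (ℕ.+-monoˡ-< m i+1<j))

  -- The chord would close the segment from `f i` to `f j`. The disjunction exempts the closing step
  -- from `f m` to `f 0`.
  no-backward-chord : ∀ {i j} → i ℕ.< j → j ℕ.≤ m → 0 ℕ.< i ⊎ j ℕ.< m → ¬ T (f j) (f i)
  no-backward-chord {i} {j} i<j j≤m inner t = shortest (l<m inner) (f j) (t ∷ walk-to (ℕ.<⇒≤ i<j))
    where
    l<m : 0 ℕ.< i ⊎ j ℕ.< m → j ∸ i ℕ.< m
    l<m (inj₁ 0<i) = ℕ.<-≤-trans (ℕ.∸-monoʳ-< 0<i (ℕ.<⇒≤ i<j)) j≤m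
    l<m (inj₂ j<m) = ℕ.≤-<-trans (ℕ.m∸n≤m j i) j<m

  -- Applied twice: to the arcs of the graph with `S` the unreversed ones, and to the flipped arcs
  -- with `S` the flipped reversed ones.
  module _ {A S : Rel V 0ℓ} (acyclic : Acyclic A) (total : ∀ {a b} → A a b → T a b ⊎ T b a)
           (T∧A⇒S : ∀ {a b} → A a b → T a b → S a b) where

    no-chord : ∀ {i j} → suc i ℕ.< j → j ℕ.≤ m → 0 ℕ.< i ⊎ j ℕ.< m → ¬ A (f i) (f j)
    no-chord i+1<j j≤m inner a with total a
    ... | inj₁ t = no-forward-chord i+1<j j≤m t
    ... | inj₂ t = no-backward-chord (ℕ.<-trans (ℕ.n<1+n _) i+1<j) j≤m inner t

    -- A target beyond `suc i` would give a chord; a target at or before `i` would close an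
    -- `A`-cycle, by the hypothesis that all earlier vertices reach `f i`. `follow` carries this
    -- hypothesis along as its invariant.
    next : ∀ {i j} → 0 ℕ.< i → (∀ {k} → k ℕ.< i → TransClosure A (f k) (f i)) →
           j ℕ.≤ m → A (f i) (f j) → j ≡ suc i
    next {i} {j} 0<i before j≤m a with ℕ.<-cmp j (suc i)
    ... | tri≈ _ eq _ = eq
    ... | tri> _ _ gt = contradiction a (no-chord gt j≤m (inj₁ 0<i))
    ... | tri< (s≤s j≤i) _ _ with ℕ.m≤n⇒m<n∨m≡n j≤i
    ...   | inj₁ j<i  = contradiction (a ∷ before j<i) (acyclic _)
    ...   | inj₂ refl = contradiction [ a ] (acyclic _)

    private
      extend : ∀ {i} → (∀ {k} → k ℕ.< i → TransClosure A (f k) (f i)) → A (f i) (f (suc i)) →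
               ∀ {k} → k ℕ.< suc i → TransClosure A (f k) (f (suc i))
      extend before a (s≤s k≤i) with ℕ.m≤n⇒m<n∨m≡n k≤i
      ... | inj₁ k<i  = before k<i Plus.∷ʳ a
      ... | inj₂ refl = [ a ]

    follow : ∀ {i} → 0 ℕ.< i → (∀ {k} → k ℕ.< i → TransClosure A (f k) (f i)) →
             TransClosure (OnSubset.ArcIn A U) (f i) (f m) → TransClosure S (f i) (f m)
    follow {i} 0<i before [ (_ , _ , a) ] with eq ← next 0<i before ℕ.≤-refl a =
      [ T∧A⇒S a (subst (λ j → T (f i) (f j)) (sym eq) (step i)) ]
    follow {i} 0<i before ((_ , Uw , a) ∷ p) with j , j≤m , refl ← covered Uw
      with refl ← next 0<i before j≤m a =
      T∧A⇒S a (step i) ∷ follow (s≤s z≤n) (extend before a) p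

    -- Without chords, a path of length at least 2 from f 0 to f m on the vertices of the tour
    -- has to run along the tour.
    follow-long : LongPath (OnSubset.ArcIn A U) (f 0) (f m) → TransClosure S (f 0) (f m)
    follow-long (w , (_ , Uw , a) , p) with covered Uw
    ... | zero , _ , refl = contradiction [ a ] (acyclic _)
    ... | suc zero , _ , refl = T∧A⇒S a (step 0) ∷ follow (s≤s z≤n) (extend (λ ()) a) p
    ... | suc (suc j) , j≤m , refl with ℕ.m≤n⇒m<n∨m≡n j≤m
    ...   | inj₁ j<m  = contradiction a (no-chord (s≤s (s≤s z≤n)) j≤m (inj₂ j<m))
    ...   | inj₂ refl = contradiction (map⁺ (OnSubset.ArcIn⇒A A U) p) (acyclic _)

-- Forests of reduced arcs in vertebrate graphs

module _ (D : DAG) where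
  open DAG D

  module _ {U : Pred Vertex 0ℓ} (U? : Unary.Decidable U) where
    open OnSubset Arc U

    subset : Subset size
    subset = tabulate (λ v → does (U? v))

    U⇒∈ : ∀ {v} → U v → v ∈ˢ subset
    U⇒∈ {v} Uv = lookup⇒[]= v subset (trans (lookup∘tabulate _ v) (dec-true (U? v) Uv))

    ∈⇒U : ∀ {v} → v ∈ˢ subset → U v
    ∈⇒U {v} v∈ with U? v | trans (sym (lookup∘tabulate _ v)) ([]=⇒lookup v∈)
    ... | yes Uv | _ = Uv

    reduced⇒U : ∀ {u v} → SymClosure Reduced u v → U u × U v
    reduced⇒U (fwd ((Uu , Uv , _) , _)) = Uu , Uv
    reduced⇒U (bwd ((Uu , Uv , _) , _)) = Uv , Uu

    private
      linked⇒All : ∀ {x} xs → Linked (SymClosure Reduced) (xs ∷ʳ x) → All (_∈ˢ subset) xs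
      linked⇒All []           _       = []
      linked⇒All (_ ∷ [])     (r ∷ _) = U⇒∈ (proj₁ (reduced⇒U r)) ∷ []
      linked⇒All (_ ∷ y ∷ xs) (r ∷ l) = U⇒∈ (proj₁ (reduced⇒U r)) ∷ linked⇒All (y ∷ xs) l

      map-proj₁-toList : ∀ {xs} (pxs : All (_∈ˢ subset) xs) → map proj₁ (All.toList pxs) ≡ xs
      map-proj₁-toList []         = refl
      map-proj₁-toList (px ∷ pxs) = cong (_ ∷_) (map-proj₁-toList pxs)

      lift-reduced : ∀ {x y : ∃ (_∈ˢ subset)} → Reduced (proj₁ x) (proj₁ y) →
                     TransReduction (Induced D subset) x y
      lift-reduced {x} ((_ , _ , a) , ¬long) = a , λ (w , b , p) →
        ¬long (proj₁ w , arcIn {x} {w} b , gmap⁺ proj₁ (λ {x} {y} → arcIn {x} {y}) p)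
        where
        arcIn : ∀ {x y : ∃ (_∈ˢ subset)} → Arc (proj₁ x) (proj₁ y) → ArcIn (proj₁ x) (proj₁ y)
        arcIn {_ , x∈} {_ , y∈} a = ∈⇒U x∈ , ∈⇒U y∈ , a

    -- Every vertex of a cycle is an endpoint of a reduced arc and so lies in `U`; hence the cycle
    -- lifts to the subgraph induced by `subset`.
    vertebrate⇒forest : Vertebrate D → Forest Reduced
    vertebrate⇒forest vertebrate x xs (2≤ , unique , linked)
      with px ∷ pxs ← linked⇒All (x ∷ xs) linked
      = vertebrate subset (x , px) (All.toList pxs)
          ( subst (2 ℕ.≤_) (trans (cong length (sym eq)) (length-map proj₁ (All.toList pxs))) 2≤
          , Unique.map⁻ (subst (λ ys → Unique (x ∷ ys)) (sym eq) unique)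
          , Linked.map
              (λ {y} {z} → Sym.gmap {R = Reduced on proj₁} id
                (λ {y} {z} → lift-reduced {y} {z}) ∘ unproj {y} {z})
              (Linked.map⁻ (subst (Linked (SymClosure Reduced)) eq′ linked)))
      where
      eq : map proj₁ (All.toList pxs) ≡ xs
      eq = map-proj₁-toList pxs
      eq′ : x ∷ (xs ∷ʳ x) ≡ map proj₁ ((x , px) ∷ (All.toList pxs ∷ʳ (x , px)))
      eq′ = cong (x ∷_) (sym (trans (map-++ proj₁ (All.toList pxs) _) (cong (_∷ʳ x) eq)))
      unproj : ∀ {y z : ∃ (_∈ˢ subset)} → SymClosure Reduced (proj₁ y) (proj₁ z) →
               SymClosure (Reduced on proj₁) y z
      unproj (fwd r) = fwd r
      unproj (bwd r) = bwd r

  -- The reachability order and decidability of paths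

  infix 4 _<_

  _<_ : Rel Vertex 0ℓ
  _<_ = TransClosure Arc

  <-isStrictPartialOrder : IsStrictPartialOrder _≡_ _<_
  <-isStrictPartialOrder = record
    { isEquivalence = isEquivalence
    ; irrefl        = λ { refl p → acyclic _ p }
    ; trans         = Plus._++_
    ; <-resp-≈      = resp₂ _<_
    }

  <-wellFounded : WellFounded _<_
  <-wellFounded = spo-wellFounded <-isStrictPartialOrder

  >-wellFounded : WellFounded (flip _<_)
  >-wellFounded = spo-noetherian <-isStrictPartialOrder

  module _ {R : Rel Vertex 0ℓ} (R? : Decidable R) (R⇒Arc : R ⇒ Arc) where

    transClosure? : Decidable (TransClosure R)
    transClosure? u v = go u (>-wellFounded u)
      where
      go : ∀ u → Acc (flip _<_) u → Dec (TransClosure R u v)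
      go u (acc rs) = map′ from to (R? u v ⊎-dec any? step)
        where
        -- The recursive call needs the arc `r` for its accessibility argument, so the two
        -- components cannot be decided independently.
        step : ∀ w → Dec (R u w × TransClosure R w v)
        step w with R? u w
        ... | no ¬r = no (¬r ∘ proj₁)
        ... | yes r = map′ (r ,_) proj₂ (go w (rs [ R⇒Arc r ]))
        from : R u v ⊎ (∃[ w ] R u w × TransClosure R w v) → TransClosure R u v
        from (inj₁ r)           = [ r ]
        from (inj₂ (w , r , p)) = r ∷ p
        to : TransClosure R u v → R u v ⊎ (∃[ w ] R u w × TransClosure R w v)
        to [ r ]   = inj₁ r
        to (r ∷ p) = inj₂ (_ , r , p)

    star? : Decidable (Star R)
    star? u v = map′ from to (u ≟ v ⊎-dec transClosure? u v)
      where
      from : u ≡ v ⊎ TransClosure R u v → Star R u v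
      from (inj₁ refl) = ε
      from (inj₂ p)    = ⁺⇒⋆ p
      to : ∀ {u} → Star R u v → u ≡ v ⊎ TransClosure R u v
      to ε       = inj₁ refl
      to (r ◅ p) = inj₂ (r ◅⁺ p)

  -- Paths in the transitive reduction

  module _ {U : Pred Vertex 0ℓ} (U? : Unary.Decidable U) where
    open OnSubset Arc U

    arcIn? : Decidable ArcIn
    arcIn? u v = U? u ×-dec U? v ×-dec arc? u v

    longPath? : Decidable (LongPath ArcIn)
    longPath? u v = any? λ w → arcIn? u w ×-dec transClosure? arcIn? ArcIn⇒A w v

    reduced? : Decidable Reduced
    reduced? u v = arcIn? u v ×-dec ¬? (longPath? u v)

    -- Splitting an arc u → v at w leaves two smaller intervals: u → w lowers the upper end and
    -- w → v raises the lower end.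
    reduced-path : TransClosure ArcIn ⇒ Star Reduced
    reduced-path {u} {v} = go (<-wellFounded v) (>-wellFounded u)
      where
      go : ∀ {u v} → Acc _<_ v → Acc (flip _<_) u → TransClosure ArcIn u v → Star Reduced u v
      long : ∀ {u v} → Acc _<_ v → Acc (flip _<_) u → LongPath ArcIn u v → Star Reduced u v
      go {u} {v} v-acc u-acc [ a ] with longPath? u v
      ... | yes l    = long v-acc u-acc l
      ... | no ¬long = (a , ¬long) ◅ ε
      go v-acc u-acc (a ∷ p) = long v-acc u-acc (_ , a , p)
      long (acc below) (acc above) (w , a , p) =
        go (below (map⁺ ArcIn⇒A p)) (acc above) [ a ] ◅◅
        go (acc below) (above [ ArcIn⇒A a ]) p

    reduced-⋆ : Star ArcIn ⇒ Star Reduced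
    reduced-⋆ = Star.concat ∘ Star.map (reduced-path ∘ [_])

    -- The cycle leads from u through p to the first vertex x that is also reachable from q, and
    -- back to u through q.
    reduced-fork : Vertebrate D → ∀ {u p q v} → Reduced u p → Reduced u q → p ≢ q →
                   Star ArcIn p v → ¬ Star ArcIn q v
    reduced-fork vertebrate {u} {p} {q} u→p u→q p≢q p→⋆v q→⋆v
      with as , x , up , as∉ , q→⋆x , p∈ ←
        split-at-first (star? reduced? Reduced⇒A q) u→p (reduced-⋆ p→⋆v) (reduced-⋆ q→⋆v)
      with rs , down , reach , q∈ ← backtrack u→q q→⋆x
      = vertebrate⇒forest U? vertebrate u (as ++ x ∷ rs)
          (2≤length as rs p∈ q∈ , unique , linked)
      where
      2≤length : ∀ as rs → p ∈ as ∷ʳ x → q ∈ x ∷ rs → 2 ℕ.≤ length (as ++ x ∷ rs)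
      2≤length []           []      (here refl) (here refl) = contradiction refl p≢q
      2≤length []           (_ ∷ _) _           _           = s≤s (s≤s z≤n)
      2≤length (_ ∷ [])     _       _           _           = s≤s (s≤s z≤n)
      2≤length (_ ∷ _ ∷ _)  _       _           _           = s≤s (s≤s z≤n)

      reduced-acyclic : Acyclic Reduced
      reduced-acyclic v = acyclic v ∘ map⁺ Reduced⇒A

      reachable : All (Star Reduced q) (x ∷ rs)
      reachable = q→⋆x ∷ reach

      unique : Unique (u ∷ as ++ x ∷ rs)
      -- The two sides are disjoint: `x` and `rs` are reachable from `q`, whereas no vertex of `as`
      -- is, and neither is `u`, by acyclicity.
      unique = Unique.++⁺
        (linked⇒unique reduced-acyclic (linked-++⁻ˡ (u ∷ as) up))
        (linked⇒unique (acyclic-flip reduced-acyclic) (linked-++⁻ˡ (x ∷ rs) down))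
        λ { (here refl , y∈) → reduced-acyclic u (u→q ◅⁺ All.lookup reachable y∈)
          ; (there y∈as , y∈) → All.lookup as∉ y∈as (All.lookup reachable y∈) }

      linked : Linked (SymClosure Reduced) (u ∷ ((as ++ x ∷ rs) ∷ʳ u))
      linked = subst (λ ys → Linked _ (u ∷ ys)) (sym (++-assoc as (x ∷ rs) _))
        (linked-glue (u ∷ as) (Linked.map fwd up) (Linked.map bwd down))

  -- Parallel paths in disjoint arc sets

  Remainder : Rel Vertex 0ℓ → Rel Vertex 0ℓ
  Remainder B u v = Arc u v × ¬ B u v

  -- Necessary for reversing `B` to be acyclic: a reversed arc and an unreversed path parallel to it
  -- form a directed cycle.
  Coclosed : Rel Vertex 0ℓ → Set
  Coclosed B = ∀ {u v} → B u v → ¬ TransClosure (Remainder B) u v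

  module _ {R : Rel Vertex 0ℓ} (R? : Decidable R) (R⇒Arc : R ⇒ Arc) where

    between? : ∀ u v → Unary.Decidable (Between R u v)
    between? u v x = transClosure? R? R⇒Arc u x ×-dec star? R? R⇒Arc x v

    least-step : ∀ {u v} → TransClosure R u v →
      ∃[ p ] R u p × Star R p v × (∀ {x} → Between R u v x → ¬ Arc x p)
    least-step {u} {v} u→v with p , r , p→v ← uncons⁺ u→v = go (<-wellFounded p) r p→v
      where
      go : ∀ {p} → Acc _<_ p → R u p → Star R p v →
           ∃[ p ] R u p × Star R p v × (∀ {x} → Between R u v x → ¬ Arc x p)
      go {p} (acc rs) r p→v with any? (λ x → between? u v x ×-dec arc? x p)
      ... | no none = p , r , p→v , λ x∈ a → none (_ , x∈ , a)
      -- The first vertex `p′` on an `R`-path from `u` to `x` is a strictly lower choice than `p`,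
      -- and it still leads to `v` through `x`.
      ... | yes (x , (u→x , x→v) , a) with p′ , r′ , p′→x ← uncons⁺ u→x
        = go (rs (Star.map R⇒Arc p′→x ⋆++⁺ [ a ])) r′ (p′→x ◅◅ x→v)

    path-in : ∀ {u v} {U : Pred Vertex 0ℓ} → (∀ {x} → Between R u v x → U x) →
              ∀ {x} → TransClosure R u x → Star R x v → Star (OnSubset.ArcIn Arc U) x v
    path-in U⊇ u→x ε = ε
    path-in U⊇ u→x (r ◅ y→v) =
      (U⊇ (u→x , r ◅ y→v) , U⊇ (u→x Plus.∷ʳ r , y→v) , R⇒Arc r) ◅
      path-in U⊇ (u→x Plus.∷ʳ r) y→v

    -- The induction step of `closures-disjoint`: the start moves up while the end stays. It treats
    -- one side only and is used again with `R` and `N` exchanged.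
    advance : ∀ {N : Rel Vertex 0ℓ} → (N⇒Arc : N ⇒ Arc) → (∀ {u v} → N u v → ¬ R u v) → Coclosed R →
      ∀ {U : Pred Vertex 0ℓ} {u v p} →
      (∀ {x} → U x → x ≡ u ⊎ Between R u v x ⊎ Between N u v x) →
      R u p → Star R p v → (∀ {x} → Between R u v x → ¬ Arc x p) →
      LongPath (OnSubset.ArcIn Arc U) u p →
      ∃[ x ] u < x × TransClosure R x v × TransClosure N x v
    advance {N} N⇒Arc N⇒¬R coclosed {U} {u} {v} {p} U⊆ r p→v least (w , (_ , _ , a) , w→p)
      -- Here `x` is the last vertex before `p` on the long path. It is not `u`, to which the path
      -- would have returned, nor on an `R`-path, by the choice of `p`.
      with x , w→x , (Ux , _ , b) ← unsnoc⁺ w→p with U⊆ Ux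
    ... | inj₁ refl        = contradiction (a ◅⁺ Star.map (OnSubset.ArcIn⇒A Arc U) w→x) (acyclic _)
    ... | inj₂ (inj₁ x∈)   = contradiction b (least x∈)
    ... | inj₂ (inj₂ (u→x , x→v)) = x , map⁺ N⇒Arc u→x , x→p ◅⁺ p→v , nonempty x→v
      where
      x→p : R x p
      x→p = decidable-stable (R? x p) λ ¬r →
        coclosed r (map⁺ (λ n → N⇒Arc n , N⇒¬R n) u→x Plus.∷ʳ (b , ¬r))
      nonempty : Star N x v → TransClosure N x v
      -- If `x` were `v`, the arc from `x` to `p` and the path from `p` to `v` would close a cycle.
      nonempty ε       = contradiction (b ◅⁺ Star.map R⇒Arc p→v) (acyclic _)
      nonempty (n ◅ s) = n ◅⁺ s

  closures-disjoint : Vertebrate D → ∀ {R N : Rel Vertex 0ℓ} → Decidable R → Decidable N →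
    R ⇒ Arc → N ⇒ Arc → (∀ {u v} → R u v → ¬ N u v) → Coclosed R → Coclosed N →
    ∀ {u v} → TransClosure R u v → ¬ TransClosure N u v
  closures-disjoint vertebrate {R} {N} R? N? R⇒Arc N⇒Arc R⇒¬N coR coN {u} {v} = go (>-wellFounded u)
    where
    go : ∀ {u} → Acc (flip _<_) u → TransClosure R u v → ¬ TransClosure N u v
    go {u} (acc rs) u→v u→v′
      with p , r , p→v , p-least ← least-step R? R⇒Arc u→v
      with q , n , q→v , q-least ← least-step N? N⇒Arc u→v′
      = by-cases (longPath? U? u p) (longPath? U? u q)
      where
      U : Pred Vertex 0ℓ
      U x = x ≡ u ⊎ Between R u v x ⊎ Between N u v x
      U? : Unary.Decidable U
      U? x = x ≟ u ⊎-dec between? R? R⇒Arc u v x ⊎-dec between? N? N⇒Arc u v x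
      open OnSubset Arc U

      u→p : ArcIn u p
      u→p = inj₁ refl , inj₂ (inj₁ ([ r ] , p→v)) , R⇒Arc r
      u→q : ArcIn u q
      u→q = inj₁ refl , inj₂ (inj₂ ([ n ] , q→v)) , N⇒Arc n

      by-cases : Dec (LongPath ArcIn u p) → Dec (LongPath ArcIn u q) → _
      by-cases (yes l) _
        with x , u<x , x→v , x→v′ ← advance R? R⇒Arc N⇒Arc (λ n r → R⇒¬N r n) coR id r p→v p-least l
        = go (rs u<x) x→v x→v′
      by-cases _ (yes l)
        with x , u<x , x→v , x→v′ ← advance N? N⇒Arc R⇒Arc R⇒¬N coN
          ([ inj₁ , inj₂ ∘ [ inj₂ , inj₁ ]′ ]′) n q→v q-least l
        = go (rs u<x) x→v′ x→v
      by-cases (no p-reduced) (no q-reduced) =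
        reduced-fork U? vertebrate (u→p , p-reduced) (u→q , q-reduced)
          -- The two first arcs differ because no arc lies in both `R` and `N`.
          (λ { refl → R⇒¬N r n })
          (path-in R? R⇒Arc (inj₂ ∘ inj₁) [ r ] p→v)
          (path-in N? N⇒Arc (inj₂ ∘ inj₂) [ n ] q→v)

  -- A criterion for acyclic reorientations

  module _ (vertebrate : Vertebrate D) {J : Rel Vertex 0ℓ} (J? : Decidable J) (J⇒Arc : J ⇒ Arc)
           (J-coclosed : Coclosed J)
           (J-closed : ∀ {u v} → Remainder J u v → ¬ TransClosure J u v) where

    private
      T : Rel Vertex 0ℓ
      T = reorient Arc J

      T-asym : ∀ {a b} → T a b → ¬ T b a
      T-asym (inj₁ (a , _))  (inj₁ (b , _))  = acyclic _ (a ∷ [ b ])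
      T-asym (inj₁ (_ , ¬j)) (inj₂ j)        = ¬j j
      T-asym (inj₂ j)        (inj₁ (_ , ¬j)) = ¬j j
      T-asym (inj₂ i)        (inj₂ j)        = acyclic _ (J⇒Arc i ∷ [ J⇒Arc j ])

      total : ∀ {a b} → Arc a b → T a b ⊎ T b a
      total {a} {b} arc with J? a b
      ... | yes j = inj₂ (inj₂ j)
      ... | no ¬j = inj₁ (inj₁ (arc , ¬j))

      forward : ∀ {a b} → Arc a b → T a b → Remainder J a b
      forward arc (inj₁ n) = n
      forward arc (inj₂ j) = contradiction (arc ∷ [ J⇒Arc j ]) (acyclic _)

      backward : ∀ {a b} → Arc b a → T a b → J b a
      backward arc (inj₁ (a , _)) = contradiction (arc ∷ [ a ]) (acyclic _)
      backward arc (inj₂ j)       = j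

      module _ {U : Pred Vertex 0ℓ} {m : ℕ}
               (shortest : ∀ {l} → l ℕ.< m → ∀ a → ¬ Walk T (suc l) a a) where
        open OnSubset Arc U

        -- By `follow-long`, a long path parallel to the closing step runs along the rest of the
        -- tour. It is then made of reversed arcs if the closing arc is unreversed, against
        -- `J-closed`, and of unreversed arcs if that arc is reversed, against `J-coclosed`.
        last-reduced : ∀ {f} → Tour T U m f → SymClosure Reduced (f m) (f (suc m))
        last-reduced {f} tour = by-direction (subst (T (f m)) (period 0) (step m))
          where
          open Tour tour
          by-direction : T (f m) (f 0) → SymClosure Reduced (f m) (f (suc m))
          by-direction (inj₁ n) rewrite period 0 = fwd ((visits m , visits 0 , proj₁ n) , λ long →
            J-closed n (reverse⁺ (
              follow-long tour shortest (acyclic-flip acyclic) (swap ∘ total) backward (flip-long long))))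
            where
            flip-long : LongPath ArcIn (f m) (f 0) → LongPath (OnSubset.ArcIn (flip Arc) U) (f 0) (f m)
            flip-long long with w , a , p ← longPath-flip long = w , flip-in a , map⁺ flip-in p
              where
              flip-in : flip ArcIn ⇒ OnSubset.ArcIn (flip Arc) U
              flip-in (Ub , Ua , a) = Ua , Ub , a
          by-direction (inj₂ j) rewrite period 0 = bwd ((visits 0 , visits m , J⇒Arc j) , λ long →
            J-coclosed j (follow-long tour shortest acyclic total forward long))

        step-reduced : ∀ {f} → Tour T U m f → ∀ i → SymClosure Reduced (f i) (f (suc i))
        -- The first step is the closing step of the rotated tour, up to one period.
        step-reduced {f} tour zero = subst (λ v → SymClosure Reduced v (f 1)) (Tour.period tour 0)
          (subst (λ v → SymClosure Reduced (f (suc m)) v) (Tour.period tour 1)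
            (last-reduced (shift-tour tour)))
        step-reduced tour (suc i) = step-reduced (shift-tour tour) i

      -- Strong induction provides the minimality of the walk. One or two steps contradict
      -- asymmetry; from three steps on, the tour is a cycle of reduced arcs on its own vertex set.
      no-closed-walk : ∀ m a → ¬ Walk T (suc m) a a
      no-closed-walk = <-rec _ λ
        { zero          shortest a (t ∷ [])      → T-asym t t
        ; (suc zero)    shortest a (t ∷ u ∷ [])  → T-asym t u
        ; m@(suc (suc _)) shortest a w → no-long m (s≤s (s≤s z≤n)) (λ l<m → shortest l<m) w }
        where
        open DecMembership (_≟_ {size}) using (_∈?_)
        no-long : ∀ m {a} → 2 ℕ.≤ m →
                  (∀ {l} → l ℕ.< m → ∀ a → ¬ Walk T (suc l) a a) → ¬ Walk T (suc m) a a
        no-long m 2≤m shortest w with f , tour ← closed-walk⇒tour w =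
          vertebrate⇒forest (_∈? applyUpTo f (suc m)) vertebrate (f 0) (applyUpTo (f ∘ suc) m)
            ( subst (2 ℕ.≤_) (sym (length-applyUpTo (f ∘ suc) m)) 2≤m
            , Unique.applyUpTo⁺₁ f (suc m) (distinct tour shortest)
            , subst (λ xs → Linked (SymClosure (OnSubset.Reduced Arc (_∈ applyUpTo f (suc m))))
                                   (f 0 ∷ xs)) closes
                -- One entry more than there are vertices, since the list ends with the return to
                -- `f 0`.
                (Linked.applyUpTo⁺₂ f (suc (suc m)) (step-reduced shortest tour)) )
          where
          closes : applyUpTo (f ∘ suc) (suc m) ≡ applyUpTo (f ∘ suc) m ∷ʳ f 0
          closes = trans (sym (applyUpTo-∷ʳ (f ∘ suc) m))
                     (cong (applyUpTo (f ∘ suc) m ∷ʳ_) (Tour.period tour 0))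

    reorient-acyclic : Acyclic T
    reorient-acyclic v p with n , w ← ⁺⇒walk p = no-closed-walk n v w

  -- The closure of a coclosed arc set and its complement

  module Closure (vertebrate : Vertebrate D) {R : Rel Vertex 0ℓ} (R? : Decidable R) (R⇒Arc : R ⇒ Arc)
                 (R-coclosed : Coclosed R) where

    J : Rel Vertex 0ℓ
    J u v = Arc u v × TransClosure R u v

    J? : Decidable J
    J? u v = arc? u v ×-dec transClosure? R? R⇒Arc u v

    -- `J` serves the join, with `R` the arcs reversed somewhere; `M` serves the meet, with `R` the
    -- arcs unreversed somewhere.
    M : Rel Vertex 0ℓ
    M u v = Arc u v × ¬ TransClosure R u v

    M? : Decidable M
    M? u v = arc? u v ×-dec ¬? (transClosure? R? R⇒Arc u v)

    J⁺⇒R⁺ : TransClosure J ⇒ TransClosure R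
    J⁺⇒R⁺ = concat⁺ ∘ map⁺ proj₂

    Remainder-M⇒J : Remainder M ⇒ J
    Remainder-M⇒J {u} {v} (a , ¬m) =
      a , decidable-stable (transClosure? R? R⇒Arc u v) λ ¬p → ¬m (a , ¬p)

    -- Each arc outside `M` is parallel to an `R`-path, and concatenating these makes a path outside
    -- `M` parallel to an `R`-path.
    M-coclosed : Coclosed M
    M-coclosed (_ , ¬p) = ¬p ∘ J⁺⇒R⁺ ∘ map⁺ Remainder-M⇒J

    R⁺∧M⁺⇒⊥ : ∀ {u v} → TransClosure R u v → ¬ TransClosure M u v
    R⁺∧M⁺⇒⊥ = closures-disjoint vertebrate R? M? R⇒Arc proj₁ (λ r (_ , ¬p) → ¬p [ r ])
      R-coclosed M-coclosed

    -- Coclosedness of `J` is the disjointness `R⁺∧M⁺⇒⊥`, closedness the idempotence of transitive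
    -- closure. For `M` the two conditions change places.
    J-acyclic : Acyclic (reorient Arc J)
    J-acyclic = reorient-acyclic vertebrate J? proj₁
      (λ (_ , p) → R⁺∧M⁺⇒⊥ p ∘ map⁺ λ (a , ¬j) → a , λ p → ¬j (a , p))
      (λ (a , ¬j) p → ¬j (a , J⁺⇒R⁺ p))

    M-acyclic : Acyclic (reorient Arc M)
    M-acyclic = reorient-acyclic vertebrate M? proj₁ M-coclosed
      (R⁺∧M⁺⇒⊥ ∘ proj₂ ∘ Remainder-M⇒J)

  -- Joins and meets of acyclic reorientations

  module _ (E : AcyclicReorientation D) where
    open AcyclicReorientation E using (reversed?; reversed⊆arc) renaming (acyclic to E-acyclic)

    reversed-coclosed : Coclosed (Reversed E)
    reversed-coclosed r p = E-acyclic _ (inj₂ r ∷ map⁺ inj₁ p)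

    reversed-closed : ∀ {u v} → Unreversed E u v → ¬ TransClosure (Reversed E) u v
    reversed-closed n p = E-acyclic _ (inj₁ n ∷ map⁺ inj₂ (reverse⁺ p))

  module _ (vertebrate : Vertebrate D) {k : ℕ} (E : Fin k → AcyclicReorientation D) where
    open AcyclicReorientation using (reversed?; reversed⊆arc)

    private
      module Join = Closure vertebrate {SomeReversed D E}
        (λ u v → any? λ i → reversed? (E i) u v)
        (λ (i , r) → reversed⊆arc (E i) r)
        -- Coclosed sets have coclosed unions: a path outside the union is outside every member.
        (λ (i , r) → reversed-coclosed (E i) r ∘ map⁺ λ (a , ¬r) → a , λ r → ¬r (i , r))

      module Meet = Closure vertebrate {SomeUnreversed D E}
        (λ u v → any? λ i → arc? u v ×-dec ¬? (reversed? (E i) u v))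
        (λ (i , a , _) → a)
        (λ (i , n) → reversed-closed (E i) n ∘ map⁺ λ (a , ¬n) →
          decidable-stable (reversed? (E i) _ _) λ ¬r → ¬n (i , a , ¬r))

    join : AcyclicReorientation D
    join = record
      { Reversed     = JoinArcs D E
      ; reversed?    = Join.J?
      ; reversed⊆arc = proj₁
      ; acyclic      = Join.J-acyclic
      }

    meet : AcyclicReorientation D
    meet = record
      { Reversed     = MeetArcs D E
      ; reversed?    = Meet.M?
      ; reversed⊆arc = proj₁
      ; acyclic      = Meet.M-acyclic
      }

    -- An upper bound `F` reverses every arc of the paths in question, hence by `reversed-closed`
    -- also the arcs of `D` parallel to them.
    join-isJoin : IsJoin (AR D) E join
    join-isJoin =
      (λ i r → reversed⊆arc (E i) r , [ i , r ]) ,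
      (λ F E≤F (a , p) → decidable-stable (reversed? F _ _) λ ¬r →
        reversed-closed F (a , ¬r) (map⁺ (λ (i , r) → E≤F i r) p))

    -- An arc unreversed in some `E i` is unreversed in every lower bound `F`, and by
    -- `reversed-coclosed` no arc reversed in `F` is parallel to a path of such arcs.
    meet-isMeet : IsMeet (AR D) E meet
    meet-isMeet =
      (λ i (a , ¬p) → decidable-stable (reversed? (E i) _ _) λ ¬r → ¬p [ i , a , ¬r ]) ,
      (λ F F≤E r → reversed⊆arc F r , λ p →
        reversed-coclosed F r (map⁺ (λ (i , a , ¬r) → a , λ r → ¬r (F≤E i r)) p))

-- The lattice from joins and meets of pairs

pair : ∀ {a} {A : Set a} → A → A → Fin 2 → A
pair x y zero    = x
pair x y (suc _) = y

module _ {c ℓ₁ ℓ₂} (P : Poset c ℓ₁ ℓ₂) where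
  private module P = Poset P

  hasLattice : (_∨_ _∧_ : P.Carrier → P.Carrier → P.Carrier) →
               (∀ x y → IsJoin P (pair x y) (x ∨ y)) →
               (∀ x y → IsMeet P (pair x y) (x ∧ y)) → HasLattice P
  hasLattice _∨_ _∧_ isJoin isMeet = _∨_ , _∧_ , record
    { isPartialOrder = P.isPartialOrder
    ; supremum       = λ x y → let upper , least = isJoin x y in
        upper zero , upper (suc zero) , λ z x≤z y≤z → least z λ { zero → x≤z ; (suc _) → y≤z }
    ; infimum        = λ x y → let lower , greatest = isMeet x y in
        lower zero , lower (suc zero) , λ z z≤x z≤y → greatest z λ { zero → z≤x ; (suc _) → z≤y }
    }

theorem9 : (D : DAG) → Vertebrate D →
    HasLattice (AR D)
    × (∀ (k : ℕ) (E : Fin k → AcyclicReorientation D) →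
    (Σ[ J ∈ AcyclicReorientation D ]
    (Reversed J ⇔ JoinArcs D E) × IsJoin (AR D) E J)
    × (Σ[ M ∈ AcyclicReorientation D ]
    (Reversed M ⇔ MeetArcs D E) × IsMeet (AR D) E M))
theorem9 D vertebrate =
  hasLattice (AR D)
    (λ E F → join D vertebrate (pair E F))
    (λ E F → meet D vertebrate (pair E F))
    (λ E F → join-isJoin D vertebrate (pair E F))
    (λ E F → meet-isMeet D vertebrate (pair E F)) ,
  λ k E →
    (join D vertebrate E , (id , id) , join-isJoin D vertebrate E) ,
    (meet D vertebrate E , (id , id) , meet-isMeet D vertebrate E)
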